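{- Let $(\mathbb{F},\star)$ be a Catalan normed magma with generator $\varepsilon$ and norm $\|\cdot\|$ with $\|\varepsilon\|=1$, and let $\mathbb{F}_n=\{u\in\mathbb{F}:\|u\|=n\}$ be the subset of elements of norm $n$. Then the number $N_{n,k}$ of elements of $\mathbb{F}_n$ whose decomposition has exactly $k$ right multiplications by the generator is given by the Narayana distribution $$N_{n,k}=\frac{1}{n-1}\binom{n-1}{k}\binom{n-1}{k-1},\qquad 1\le k\le n-1.$$
   Context: Here $\mathbb{N}=\{1,2,3,\dots\}$. A magma $(\mathbb{F},\star)$ is a non-empty countable set $\mathbb{F}$ together with a map $\star:\mathbb{F}\times\mathbb{F}\to\mathbb{F}$ (no further conditions). A magma morphism is a map between magmas preserving the products. A magma $(\mathbb{F},\star)$ is free if there exist a set $\mathcal{Y}$ and a map $i:\mathcal{Y}\to\mathbb{F}$ such that for every magma $(\mathcal{N},\bullet)$ and every map $f:\mathcal{Y}\to\mathcal{N}$ there is a unique magma morphism $\theta:\mathbb{F}\to\mathcal{N}$ with $f=\theta\circ i$; the elements of $i(\mathcal{Y})$ are the generators. An element is irreducible if it is not in the range of $\star$. A norm is a map $\|\cdot\|:\mathbb{F}\to\mathbb{N}$ with $\|u\star v\|\ge\|u\|+\|v\|$ for all $u,v$; it is additive if equality always holds. A Catalan normed magma is a normed magma that is free, whose norm is additive, and which has exactly one irreducible element, the generator $\varepsilon$ (whose norm is by convention $1$). The decomposition of an element $u\in\mathbb{F}$ is its (unique) expression as a fully bracketed product of copies of $\varepsilon$. The number of right multiplications by the generator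 in the decomposition of $u$ is the number of occurrences of $\star$ in this expression whose right-hand factor is the single generator $\varepsilon$. For example $\varepsilon\star(\varepsilon\star(\varepsilon\star\varepsilon))$ has $1$, $(\varepsilon\star\varepsilon)\star(\varepsilon\star\varepsilon)$ has $2$ and $((\varepsilon\star\varepsilon)\star\varepsilon)\star\varepsilon$ has $3$ right multiplications by the generator. -}

module Defs where

open import Algebra.Bundles using (Magma)
open import Algebra.Morphism.Structures using (module MagmaMorphisms)
open import Data.Fin.Base using (Fin)
open import Data.Nat.Base using (ℕ; zero; suc; _+_; _≤_)
open import Data.Product using (Σ; ∃!; ∃-syntax; _×_; proj₁)
open import Function.Bundles using (Func; Injection; Bijection)
open import Level using (Level; _⊔_) renaming (suc to lsuc)
open import Relation.Binary.Bundles using (Setoid)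
open import Relation.Binary.PropositionalEquality using (_≡_; refl; setoid)
import Relation.Binary.Construct.On as On
open import Relation.Nullary using (¬_)

-- Sets are setoids throughout: maps respect _≈_, and maps are equal when they
-- agree pointwise.

-- Countable means finite or countably infinite.
Countable : ∀ {a ℓ} → Setoid a ℓ → Set (a ⊔ ℓ)
Countable S = Injection S (setoid ℕ)

record CountableMagma (c ℓ : Level) : Set (lsuc (c ⊔ ℓ)) where
  field
    magma     : Magma c ℓ
    nonEmpty  : Magma.Carrier magma
    countable : Countable (Magma.setoid magma)

  open Magma magma public
    using (Carrier; _≈_; rawMagma)
    renaming (_∙_ to infixl 7 _⋆_; setoid to carrierSetoid)

IsMorphism : ∀ {c ℓ} (M N : CountableMagma c ℓ) →
             (CountableMagma.Carrier M → CountableMagma.Carrier N) → Set (c ⊔ ℓ)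
IsMorphism M N =
  MagmaMorphisms.IsMagmaHomomorphism (CountableMagma.rawMagma M) (CountableMagma.rawMagma N)

IsMorphismExtending : ∀ {c ℓ} {Y : Setoid c ℓ} (F N : CountableMagma c ℓ) →
                      Func Y (CountableMagma.carrierSetoid F) →
                      Func Y (CountableMagma.carrierSetoid N) →
                      (CountableMagma.Carrier F → CountableMagma.Carrier N) → Set (c ⊔ ℓ)
IsMorphismExtending F N i f θ =
  IsMorphism F N θ × (∀ y → CountableMagma._≈_ N (Func.to f y) (θ (Func.to i y)))

record Free {c ℓ : Level} (F : CountableMagma c ℓ) : Set (lsuc (c ⊔ ℓ)) where
  open CountableMagma F
  field
    Y         : Setoid c ℓ
    i         : Func Y carrierSetoid
    universal : (N : CountableMagma c ℓ) (f : Func Y (CountableMagma.carrierSetoid N)) →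
                ∃! (λ θ φ → ∀ u → CountableMagma._≈_ N (θ u) (φ u))
                   (IsMorphismExtending F N i f)

  IsGenerator : Carrier → Set (c ⊔ ℓ)
  IsGenerator u = ∃[ y ] Func.to i y ≈ u

module _ {c ℓ : Level} (F : CountableMagma c ℓ) where
  open CountableMagma F

  Irreducible : Carrier → Set (c ⊔ ℓ)
  Irreducible u = ∀ v w → ¬ (v ⋆ w ≈ u)

  -- ‖_‖-positive is needed because norms take values in {1,2,3,…}, whereas the
  -- library's ℕ contains 0.
  record IsNorm (‖_‖ : Carrier → ℕ) : Set (c ⊔ ℓ) where
    field
      ‖_‖-cong      : ∀ {u v} → u ≈ v → ‖ u ‖ ≡ ‖ v ‖
      ‖_‖-positive  : ∀ u → 1 ≤ ‖ u ‖
      superadditive : ∀ u v → ‖ u ‖ + ‖ v ‖ ≤ ‖ u ⋆ v ‖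

  IsAdditive : (Carrier → ℕ) → Set c
  IsAdditive ‖_‖ = ∀ u v → ‖ u ⋆ v ‖ ≡ ‖ u ‖ + ‖ v ‖

record CatalanNormedMagma (c ℓ : Level) : Set (lsuc (c ⊔ ℓ)) where
  field
    countableMagma : CountableMagma c ℓ

  open CountableMagma countableMagma public

  field
    ‖_‖           : Carrier → ℕ
    isNorm        : IsNorm countableMagma ‖_‖
    additive      : IsAdditive countableMagma ‖_‖
    free          : Free countableMagma
    ε             : Carrier
    ε-generator   : Free.IsGenerator free ε
    ε-irreducible : Irreducible countableMagma ε
    ε-unique      : ∀ u → Irreducible countableMagma u → u ≈ ε
    ‖ε‖≡1         : ‖ ε ‖ ≡ 1

-- Fully bracketed products of copies of one symbol e.
infixl 7 _·_
data Bracketing : Set where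
  e   : Bracketing
  _·_ : Bracketing → Bracketing → Bracketing

-- The number of products in the expression whose right-hand factor is e alone.
rightMults : Bracketing → ℕ
rightMults e                 = 0
rightMults (s · e)           = suc (rightMults s)
rightMults (s · t@(_ · _))   = rightMults s + rightMults t

_ : rightMults (e · (e · (e · e))) ≡ 1
_ = refl

_ : rightMults ((e · e) · (e · e)) ≡ 2
_ = refl

_ : rightMults (((e · e) · e) · e) ≡ 3
_ = refl

module _ {c ℓ : Level} (F : CatalanNormedMagma c ℓ) where
  open CatalanNormedMagma F

  ⟦_⟧ : Bracketing → Carrier
  ⟦ e ⟧     = ε
  ⟦ s · t ⟧ = ⟦ s ⟧ ⋆ ⟦ t ⟧

  _IsDecompositionOf_ : Bracketing → Carrier → Set ℓ
  t IsDecompositionOf u = ⟦ t ⟧ ≈ u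

  HasRightMults : Carrier → ℕ → Set ℓ
  HasRightMults u k = ∃[ t ] (t IsDecompositionOf u × rightMults t ≡ k)

  -- A subset of the magma: two of its members are equal when the underlying
  -- elements are, whatever the proofs of membership.
  ElementsOf : ℕ → ℕ → Setoid (c ⊔ ℓ) ℓ
  ElementsOf n k =
    On.setoid {B = Σ Carrier λ u → ‖ u ‖ ≡ n × HasRightMults u k} carrierSetoid proj₁

HasCardinality : ∀ {a ℓ} → Setoid a ℓ → ℕ → Set (a ⊔ ℓ)
HasCardinality S N = Bijection (setoid (Fin N)) S

-- By freeness, F is the magma of bracketings: the morphism to the bracketings
-- that sends every generator to e inverts ⟦_⟧.  Bracketings are counted through
-- stacks: popping the root product s · t of the top bracketing of a stack, and
-- pushing s and then t, removes one product, and it removes one right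
-- multiplication exactly when t is e.  (Writing s · t as s U t D, a stack of
-- height h is a prefix of a Dyck path ending at height h, a right multiplication
-- is a peak, and popping erases a last step D.)  The numbers of stacks with and
-- without e on top thus satisfy linear recurrences, which are solved by 2 × 2
-- determinants of binomial coefficients.
module Submission where

open import Defs
open import Algebra.Morphism.Structures using (module MagmaMorphisms)
open import Data.Empty using (⊥-elim)
open import Data.Fin.Base using (zero; suc)
import Data.Integer.Base as ℤ
open import Data.Integer.Base using (+_)
import Data.Integer.Properties as ℤ
open import Data.List.Base using (List; []; _∷_; _++_; map; length; lookup)
open import Data.List.Membership.Propositional using (_∈_)
open import Data.List.Membership.Propositional.Properties
  using (∈-map⁺; ∈-++⁺ˡ; ∈-++⁺ʳ; ∈-lookup)
open import Data.List.Properties using (length-map; length-++)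
open import Data.List.Relation.Binary.Disjoint.Propositional using (Disjoint)
open import Data.List.Relation.Unary.All as All using (All; []; _∷_)
import Data.List.Relation.Unary.All.Properties as All
open import Data.List.Relation.Unary.AllPairs using ([]; _∷_)
open import Data.List.Relation.Unary.Any using (here; index)
open import Data.List.Relation.Unary.Any.Properties using (lookup-index)
open import Data.List.Relation.Unary.Unique.Propositional using (Unique)
import Data.List.Relation.Unary.Unique.Propositional.Properties as Unique
open import Data.Nat.Base using (ℕ; zero; suc; _∸_; _≤_; s≤s; NonZero)
import Data.Nat.Base as ℕ
open import Data.Nat.Combinatorics using (_C_; nC1≡n; nCk+nC[k+1]≡[n+1]C[k+1])
open import Data.Nat.Properties
  using (+-assoc; +-identityʳ; +-suc; +-cancelʳ-≡; *-comm; *-cancelˡ-≡; *-identityʳ; *-zeroʳ;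
         even≢odd; m≤n⇒∃[o]m+o≡n; 0≢1+n; suc-injective)
open import Data.Nat.Tactic.RingSolver using (solve-∀)
open import Data.Product.Base using (∃-syntax; _×_; _,_; proj₁; proj₂)
open import Data.Rational.Base using (_/_; _*_; toℚᵘ)
open import Data.Rational.Properties using (toℚᵘ-injective; toℚᵘ-fromℚᵘ; toℚᵘ-homo-*)
import Data.Rational.Unnormalised.Base as ℚᵘ
import Data.Rational.Unnormalised.Properties as ℚᵘ
open import Data.Vec.Base as Vec using (Vec; []; _∷_; head)
open import Data.Vec.Properties using (∷-injectiveʳ)
open import Level using (Lift; lift; lower)
open import Relation.Binary.Bundles using (Setoid)
open import Relation.Binary.PropositionalEquality
  using (_≡_; _≢_; refl; sym; trans; cong; cong₂; subst; module ≡-Reasoning)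

-- The countable magma of bracketings

products : Bracketing → ℕ
products e       = 0
products (s · t) = suc (products t ℕ.+ products s)

-- A binary prefix code, least significant digit first.
encode : Bracketing → ℕ → ℕ
encode e       m = 2 ℕ.* m
encode (s · t) m = suc (2 ℕ.* encode s (encode t m))

-- Parity separates `e` from a product. Recovering the tail `m` as well lets the induction pass from
-- the left factor to the right one.
encode-injective : ∀ s t {m n} → encode s m ≡ encode t n → s ≡ t × m ≡ n
encode-injective e       e       eq = refl , *-cancelˡ-≡ _ _ 2 eq
encode-injective e       (s · t) {m} {n} eq = ⊥-elim (even≢odd m (encode s (encode t n)) eq)
encode-injective (s · t) e       {m} {n} eq = ⊥-elim (even≢odd n (encode s (encode t m)) (sym eq))
encode-injective (s · t) (u · v) eq
  with refl , eq′ ← encode-injective s u (*-cancelˡ-≡ _ _ 2 (suc-injective eq))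
  with refl , m≡n ← encode-injective t v eq′ = refl , m≡n

-- The universal property ranges over magmas at the levels of `F`, hence the lifts.
bracketings : ∀ c ℓ → CountableMagma c ℓ
bracketings c ℓ = record
  { magma = record
    { Carrier = Lift c Bracketing
    ; _≈_     = λ s t → Lift ℓ (lower s ≡ lower t)
    ; _∙_     = λ s t → lift (lower s · lower t)
    ; isMagma = record
      { isEquivalence = record
        { refl  = lift refl
        ; sym   = λ (lift p) → lift (sym p)
        ; trans = λ (lift p) (lift q) → lift (trans p q)
        }
      ; ∙-cong = λ (lift p) (lift q) → lift (cong₂ _·_ p q)
      }
    }
  ; nonEmpty  = lift e
  ; countable = record
    { to        = λ t → encode (lower t) 0
    ; cong      = λ (lift p) → cong (λ t → encode t 0) p
    ; injective = λ {s} {t} eq → lift (proj₁ (encode-injective (lower s) (lower t) eq))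
    }
  }

-- Uniqueness of decompositions

module _ {c ℓ} (F : CatalanNormedMagma c ℓ) where
  open CatalanNormedMagma F
  open Free free

  ⟦⟧-injective : ∀ {s t} → ⟦_⟧ F s ≈ ⟦_⟧ F t → s ≡ t
  ⟦⟧-injective {s} {t} eq
    -- The constant map to `e` fixes `θ` at `ε`, because `ε` is the image of some `y`.
    with θ , (θ-morphism , θ-extends) , _ ← universal (bracketings c ℓ)
           (record { to = λ _ → lift e ; cong = λ _ → lift refl })
    = trans (sym (θ∘⟦⟧ s)) (trans (lower (⟦⟧-cong eq)) (θ∘⟦⟧ t))
    where
    open MagmaMorphisms.IsMagmaHomomorphism θ-morphism using (⟦⟧-cong; homo)

    θ∘⟦⟧ : ∀ t → lower (θ (⟦_⟧ F t)) ≡ t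
    θ∘⟦⟧ e with y , iy≈ε ← ε-generator =
      sym (trans (lower (θ-extends y)) (lower (⟦⟧-cong iy≈ε)))
    θ∘⟦⟧ (s · t) = trans (lower (homo _ _)) (cong₂ _·_ (θ∘⟦⟧ s) (θ∘⟦⟧ t))

  -- The norm counts leaves, of which there is one more than products.
  norm-⟦⟧ : ∀ t → ‖ ⟦_⟧ F t ‖ ≡ suc (products t)
  norm-⟦⟧ e       = ‖ε‖≡1
  norm-⟦⟧ (s · t) = begin
    ‖ ⟦_⟧ F (s · t) ‖                       ≡⟨ additive _ _ ⟩
    ‖ ⟦_⟧ F s ‖ ℕ.+ ‖ ⟦_⟧ F t ‖             ≡⟨ cong₂ ℕ._+_ (norm-⟦⟧ s) (norm-⟦⟧ t) ⟩
    suc (products s) ℕ.+ suc (products t)   ≡⟨ swap (products s) (products t) ⟩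
    suc (products (s · t))                  ∎
    where
    open ≡-Reasoning
    swap : ∀ x y → suc x ℕ.+ suc y ≡ suc (suc (y ℕ.+ x))
    swap = solve-∀

-- Stacks and grafting

-- The top of the stack is the head.
Stack : ℕ → Set
Stack h = Vec Bracketing (suc h)

weight peaks : ∀ {n} → Vec Bracketing n → ℕ
weight ts = Vec.sum (Vec.map products ts)
peaks  ts = Vec.sum (Vec.map rightMults ts)

-- Undoes a pop: the right factor was pushed last, so it lies on top.
graft : ∀ {h} → Stack (suc h) → Stack h
graft (t ∷ s ∷ ts) = s · t ∷ ts

graft-injective : ∀ {h} {f g : Stack (suc h)} → graft f ≡ graft g → f ≡ g
graft-injective {f = _ ∷ _ ∷ _} {_ ∷ _ ∷ _} refl = refl

head-graft : ∀ {h} (f : Stack (suc h)) → head (graft f) ≢ e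
head-graft (_ ∷ _ ∷ _) ()

-- `products` adds the right factor first, in stack order, so associativity is enough.
weight-graft : ∀ {h} (f : Stack (suc h)) → weight (graft f) ≡ suc (weight f)
weight-graft (t ∷ s ∷ ts) = cong suc (+-assoc (products t) _ _)

peaks-graft-leaf : ∀ {h} (f : Stack (suc h)) → head f ≡ e → peaks (graft f) ≡ suc (peaks f)
peaks-graft-leaf (e ∷ s ∷ ts) refl = refl

peaks-graft-node : ∀ {h} (f : Stack (suc h)) → head f ≢ e → peaks (graft f) ≡ peaks f
peaks-graft-node (e         ∷ s ∷ ts) t≢e = ⊥-elim (t≢e refl)
peaks-graft-node (t@(_ · _) ∷ s ∷ ts) _   =
  rearrange (rightMults s) (rightMults t) (peaks ts)
  where
  rearrange : ∀ x y z → (x ℕ.+ y) ℕ.+ z ≡ y ℕ.+ (x ℕ.+ z)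
  rearrange = solve-∀

-- Enumeration of stacks by height, products and right multiplications

leafTop nodeTop : ∀ h → ℕ → ℕ → List (Stack h)

leafTop zero    zero    zero    = (e ∷ []) ∷ []
leafTop zero    zero    (suc k) = []
leafTop zero    (suc m) k       = []
-- Removing a top leaf changes neither statistic and exposes an arbitrary top.
leafTop (suc h) m       k       = map (e ∷_) (leafTop h m k ++ nodeTop h m k)

nodeTop h zero    k       = []
nodeTop h (suc m) zero    = map graft (nodeTop (suc h) m zero)
-- Only grafting under a top leaf creates a right multiplication. Grafting uses up a unit of `m`, so
-- the recursion ends although the height grows.
nodeTop h (suc m) (suc k) = map graft (leafTop (suc h) m k ++ nodeTop (suc h) m (suc k))

Stats LeafTop NodeTop : ∀ {h} → ℕ → ℕ → Stack h → Set
Stats   m k f = weight f ≡ m × peaks f ≡ k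
LeafTop m k f = head f ≡ e × Stats m k f
NodeTop m k f = head f ≢ e × Stats m k f

leafTop-sound : ∀ h m k → All (LeafTop m k) (leafTop h m k)
nodeTop-sound : ∀ h m k → All (NodeTop m k) (nodeTop h m k)

leafTop-sound zero    zero    zero    = (refl , refl , refl) ∷ []
leafTop-sound zero    zero    (suc k) = []
leafTop-sound zero    (suc m) k       = []
leafTop-sound (suc h) m       k       = All.map⁺ (All.map (refl ,_)
  (All.++⁺ (All.map proj₂ (leafTop-sound h m k)) (All.map proj₂ (nodeTop-sound h m k))))

graft-leaf-stats : ∀ {h m k} (f : Stack (suc h)) → LeafTop m k f → NodeTop (suc m) (suc k) (graft f)
graft-leaf-stats f (leaf , w , p) =
  head-graft f , trans (weight-graft f) (cong suc w) , trans (peaks-graft-leaf f leaf) (cong suc p)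

graft-node-stats : ∀ {h m k} (f : Stack (suc h)) → NodeTop m k f → NodeTop (suc m) k (graft f)
graft-node-stats f (node , w , p) =
  head-graft f , trans (weight-graft f) (cong suc w) , trans (peaks-graft-node f node) p

nodeTop-sound h zero    k       = []
nodeTop-sound h (suc m) zero    =
  All.map⁺ (All.map (λ {f} → graft-node-stats f) (nodeTop-sound (suc h) m zero))
nodeTop-sound h (suc m) (suc k) = All.map⁺ (All.++⁺
  (All.map (λ {f} → graft-leaf-stats f) (leafTop-sound (suc h) m k))
  (All.map (λ {f} → graft-node-stats f) (nodeTop-sound (suc h) m (suc k))))

-- Makes uniform in `k` the node case, which `nodeTop` spreads over two clauses.
graft-∈-nodeTop : ∀ {h} m k {f : Stack (suc h)} →
                  f ∈ nodeTop (suc h) m k → graft f ∈ nodeTop h (suc m) k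
graft-∈-nodeTop m zero    f∈ = ∈-map⁺ graft f∈
graft-∈-nodeTop m (suc k) f∈ = ∈-map⁺ graft (∈-++⁺ʳ (leafTop _ m k) f∈)

leafTop-complete : ∀ h m k f → LeafTop m k f → f ∈ leafTop h m k
nodeTop-complete : ∀ h m k f → NodeTop m k f → f ∈ nodeTop h m k

leafTop-complete zero    _ _ (e ∷ [])             (refl , refl , refl) = here refl
leafTop-complete (suc h) m k (e ∷ f@(e ∷ _))      (refl , stats) =
  ∈-map⁺ (e ∷_) (∈-++⁺ˡ (leafTop-complete h m k f (refl , stats)))
leafTop-complete (suc h) m k (e ∷ f@(_ · _ ∷ _))  (refl , stats) =
  ∈-map⁺ (e ∷_) (∈-++⁺ʳ (leafTop h m k) (nodeTop-complete h m k f ((λ ()) , stats)))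

nodeTop-complete h m       k       (e ∷ _)            (node , _)   = ⊥-elim (node refl)
nodeTop-complete h (suc m) zero    (s · e ∷ _)        (_ , _ , ())
nodeTop-complete h (suc m) (suc k) (s · e ∷ ts)       (_ , w , p)  =
  ∈-map⁺ graft (∈-++⁺ˡ (leafTop-complete (suc h) m k (e ∷ s ∷ ts)
    (refl , suc-injective w , suc-injective p)))
nodeTop-complete h (suc m) k       (s · t@(_ · _) ∷ ts) (_ , w , p) =
  graft-∈-nodeTop m k (nodeTop-complete (suc h) m k f
    ( (λ ())
    , suc-injective (trans (sym (weight-graft f)) w)
    , trans (sym (peaks-graft-node f λ ())) p))
  where f = t ∷ s ∷ ts

-- The heads alone decide, so the parameters may differ, as they do for `nodeTop-unique`.
leafTop-nodeTop-disjoint : ∀ h m k m′ k′ → Disjoint (leafTop h m k) (nodeTop h m′ k′)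
leafTop-nodeTop-disjoint h m k m′ k′ (f∈leafTop , f∈nodeTop) =
  proj₁ (All.lookup (nodeTop-sound h m′ k′) f∈nodeTop)
        (proj₁ (All.lookup (leafTop-sound h m k) f∈leafTop))

leafTop-unique : ∀ h m k → Unique (leafTop h m k)
nodeTop-unique : ∀ h m k → Unique (nodeTop h m k)

leafTop-unique zero    zero    zero    = [] ∷ []
leafTop-unique zero    zero    (suc k) = []
leafTop-unique zero    (suc m) k       = []
leafTop-unique (suc h) m       k       = Unique.map⁺ ∷-injectiveʳ
  (Unique.++⁺ (leafTop-unique h m k) (nodeTop-unique h m k) (leafTop-nodeTop-disjoint h m k m k))

nodeTop-unique h zero    k       = []
nodeTop-unique h (suc m) zero    = Unique.map⁺ graft-injective (nodeTop-unique (suc h) m zero)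
nodeTop-unique h (suc m) (suc k) = Unique.map⁺ graft-injective
  (Unique.++⁺ (leafTop-unique (suc h) m k) (nodeTop-unique (suc h) m (suc k))
              (leafTop-nodeTop-disjoint (suc h) m k m (suc k)))

-- Cardinality of the sets of elements

lookup-injective : ∀ {a} {A : Set a} {xs : List A} → Unique xs →
                   ∀ i j → lookup xs i ≡ lookup xs j → i ≡ j
lookup-injective (_   ∷ _)  zero    zero    _  = refl
lookup-injective (x∉ ∷ _)   zero    (suc j) eq = ⊥-elim (All.lookup x∉ (∈-lookup j) eq)
lookup-injective (x∉ ∷ _)   (suc i) zero    eq = ⊥-elim (All.lookup x∉ (∈-lookup i) (sym eq))
lookup-injective (_   ∷ xs) (suc i) (suc j) eq = cong suc (lookup-injective xs i j eq)

module _ {c ℓ} (F : CatalanNormedMagma c ℓ) where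
  open CatalanNormedMagma F
  private module S = Setoid carrierSetoid

  -- Norm `m + 2` means `m + 1` products, so the decomposition is not `e` and, as a stack of height
  -- 0, occurs in `nodeTop`.
  ElementsOf-cardinality : ∀ m k →
    HasCardinality (ElementsOf F (suc (suc m)) k) (length (nodeTop 0 (suc m) k))
  ElementsOf-cardinality m k = record
    { to        = λ i → element (lookup stacks i) (sound i)
    ; cong      = λ { refl → S.refl }
    ; bijective = (λ {i} {j} eq → lookup-injective (nodeTop-unique 0 (suc m) k) i j
                     (element-injective eq))
                , surjective
    }
    where
    stacks = nodeTop 0 (suc m) k
    module E = Setoid (ElementsOf F (suc (suc m)) k)

    sound : ∀ i → NodeTop (suc m) k (lookup stacks i)
    sound i = All.lookup (nodeTop-sound 0 (suc m) k) (∈-lookup i)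

    element : ∀ f → NodeTop (suc m) k f → E.Carrier
    element (t ∷ []) (_ , w , p) =
      ⟦_⟧ F t ,
      trans (norm-⟦⟧ F t) (cong suc (trans (sym (+-identityʳ _)) w)) ,
      t , S.refl , trans (sym (+-identityʳ _)) p

    element-injective : ∀ {f g} {p : NodeTop (suc m) k f} {q : NodeTop (suc m) k g} →
                     E._≈_ (element f p) (element g q) → f ≡ g
    element-injective {_ ∷ []} {_ ∷ []} eq = cong (_∷ []) (⟦⟧-injective F eq)

    -- The variable `f` stands for a `lookup`, so that the equation can be matched with `refl`.
    element-≈ : ∀ {t f u} {p : NodeTop (suc m) k f} →
                t ∷ [] ≡ f → ⟦_⟧ F t ≈ u → proj₁ (element f p) ≈ u
    element-≈ refl t≈u = t≈u

    surjective : ∀ u → ∃[ i ] (∀ {j} → j ≡ i → proj₁ (element (lookup stacks j) (sound j)) ≈ proj₁ u)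
    surjective (u , norm , t , t≈u , p) =
      index t∈ , λ { refl → element-≈ (lookup-index t∈) t≈u }
      where
      products≡ : products t ≡ suc m
      products≡ = suc-injective
        (trans (sym (norm-⟦⟧ F t)) (trans (IsNorm.‖_‖-cong isNorm t≈u) norm))

      t∈ : (t ∷ []) ∈ stacks
      t∈ = nodeTop-complete 0 (suc m) k (t ∷ [])
        ( (λ { refl → 0≢1+n products≡ })
        , trans (+-identityʳ _) products≡
        , trans (+-identityʳ _) p)

-- Binomial identities

-- n C (k - 1), with the value 0 at k = 0 where _∸_ would give n C 0.
_C⁻_ : ℕ → ℕ → ℕ
n C⁻ zero  = 0
n C⁻ suc k = n C k

pascal : ∀ n k → n C⁻ k ℕ.+ n C k ≡ suc n C k
pascal n zero    = refl
pascal n (suc k) = nCk+nC[k+1]≡[n+1]C[k+1] n k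

-- The rule (n - k) C(n, k) = (k + 1) C(n, k + 1), free of subtraction.
absorption : ∀ n k → suc k ℕ.* (n C suc k) ℕ.+ k ℕ.* (n C k) ≡ n ℕ.* (n C k)
absorption zero    zero    = refl
absorption zero    (suc k) = cong₂ ℕ._+_ (*-zeroʳ k) (*-zeroʳ k)
absorption (suc n) zero    = begin
  1 ℕ.* (suc n C 1) ℕ.+ 0   ≡⟨ unit (suc n C 1) ⟩
  suc n C 1                 ≡⟨ nC1≡n (suc n) ⟩
  suc n                     ≡⟨ *-identityʳ (suc n) ⟨
  suc n ℕ.* (suc n C 0)     ∎
  where
  open ≡-Reasoning
  unit : ∀ x → 1 ℕ.* x ℕ.+ 0 ≡ x
  unit = solve-∀
absorption (suc n) (suc k) = begin
  suc (suc k) ℕ.* (suc n C suc (suc k)) ℕ.+ suc k ℕ.* (suc n C suc k)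
    ≡⟨ cong₂ (λ x y → suc (suc k) ℕ.* x ℕ.+ suc k ℕ.* y) (pascal n (suc (suc k))) (pascal n (suc k)) ⟨
  suc (suc k) ℕ.* (b ℕ.+ d) ℕ.+ suc k ℕ.* (a ℕ.+ b)
    ≡⟨ split k a b d ⟩
  (suc (suc k) ℕ.* d ℕ.+ suc k ℕ.* b) ℕ.+ (suc k ℕ.* b ℕ.+ k ℕ.* a) ℕ.+ (a ℕ.+ b)
    ≡⟨ cong₂ (λ x y → x ℕ.+ y ℕ.+ (a ℕ.+ b)) (absorption n (suc k)) (absorption n k) ⟩
  n ℕ.* b ℕ.+ n ℕ.* a ℕ.+ (a ℕ.+ b)
    ≡⟨ merge n a b ⟩
  suc n ℕ.* (a ℕ.+ b)
    ≡⟨ cong (suc n ℕ.*_) (pascal n (suc k)) ⟩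
  suc n ℕ.* (suc n C suc k) ∎
  where
  open ≡-Reasoning
  a = n C k
  b = n C suc k
  d = n C suc (suc k)
  split : ∀ k a b d → suc (suc k) ℕ.* (b ℕ.+ d) ℕ.+ suc k ℕ.* (a ℕ.+ b) ≡
          (suc (suc k) ℕ.* d ℕ.+ suc k ℕ.* b) ℕ.+ (suc k ℕ.* b ℕ.+ k ℕ.* a) ℕ.+ (a ℕ.+ b)
  split = solve-∀
  merge : ∀ n a b → n ℕ.* b ℕ.+ n ℕ.* a ℕ.+ (a ℕ.+ b) ≡ suc n ℕ.* (a ℕ.+ b)
  merge = solve-∀

-- Writing `n = k + q` turns `n - k` into `q`; the term `k * (n C k)` cancels.
absorption′ : ∀ k q → suc k ℕ.* ((k ℕ.+ q) C suc k) ≡ q ℕ.* ((k ℕ.+ q) C k)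
absorption′ k q = +-cancelʳ-≡ (k ℕ.* a) _ _ (begin
  suc k ℕ.* ((k ℕ.+ q) C suc k) ℕ.+ k ℕ.* a   ≡⟨ absorption (k ℕ.+ q) k ⟩
  (k ℕ.+ q) ℕ.* a                             ≡⟨ split k q a ⟩
  q ℕ.* a ℕ.+ k ℕ.* a                         ∎)
  where
  open ≡-Reasoning
  a = (k ℕ.+ q) C k
  split : ∀ k q a → (k ℕ.+ q) ℕ.* a ≡ q ℕ.* a ℕ.+ k ℕ.* a
  split = solve-∀

-- The same rule one column to the left: `k C(n, k) = (n - k + 1) C(n, k - 1)`.
absorption⁻ : ∀ k q → k ℕ.* ((k ℕ.+ q) C k) ≡ suc q ℕ.* ((k ℕ.+ q) C⁻ k)
absorption⁻ zero    q = sym (*-zeroʳ q)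
absorption⁻ (suc k) q = subst (λ n → suc k ℕ.* (n C suc k) ≡ suc q ℕ.* (n C k))
                              (+-suc k q) (absorption′ k (suc q))

-- Recurrences for the counts and their solution

∣leafTop∣ ∣nodeTop∣ : ℕ → ℕ → ℕ → ℕ
∣leafTop∣ h m k = length (leafTop h m k)
∣nodeTop∣ h m k = length (nodeTop h m k)

length-map-++ : ∀ {a b} {A : Set a} {B : Set b} (f : A → B) xs ys →
                length (map f (xs ++ ys)) ≡ length xs ℕ.+ length ys
length-map-++ f xs ys = trans (length-map f (xs ++ ys)) (length-++ xs)

∣leafTop∣-suc : ∀ h m k → ∣leafTop∣ (suc h) m k ≡ ∣leafTop∣ h m k ℕ.+ ∣nodeTop∣ h m k
∣leafTop∣-suc h m k = length-map-++ (e ∷_) (leafTop h m k) (nodeTop h m k)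

∣nodeTop∣-suc : ∀ h m k → ∣nodeTop∣ h (suc m) (suc k) ≡
                          ∣leafTop∣ (suc h) m k ℕ.+ ∣nodeTop∣ (suc h) m (suc k)
∣nodeTop∣-suc h m k = length-map-++ graft (leafTop (suc h) m k) (nodeTop (suc h) m (suc k))

-- Following right factors down from a product ends at a factor `e`, hence at a right
-- multiplication.
∣nodeTop∣-zero : ∀ h m → ∣nodeTop∣ h m 0 ≡ 0
∣nodeTop∣-zero h zero    = refl
∣nodeTop∣-zero h (suc m) = trans (length-map graft (nodeTop (suc h) m 0)) (∣nodeTop∣-zero (suc h) m)

-- Without products there is only the stack of leaves; `0 C k` is the indicator of `k = 0`.
∣leafTop∣-base : ∀ h k → ∣leafTop∣ h 0 k ≡ 0 C k
∣leafTop∣-base zero    zero    = refl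
∣leafTop∣-base zero    (suc k) = refl
∣leafTop∣-base (suc h) k       =
  trans (∣leafTop∣-suc h 0 k) (trans (+-identityʳ _) (∣leafTop∣-base h k))

-- For m + 1 products, there are C(h+m, k) C(m, k-1) - C(h+m, k-1) C(m, k) stacks
-- with e on top and k right multiplications, and there are
-- C(h+m, k) C(m, k) - C(h+m, k-1) C(m, k+1) without e on top and k + 1 of them.
∣leafTop∣-determinant : ∀ h m k →
  ∣leafTop∣ h (suc m) k ℕ.+ ((h ℕ.+ m) C⁻ k) ℕ.* (m C k) ≡ ((h ℕ.+ m) C k) ℕ.* (m C⁻ k)
∣nodeTop∣-determinant : ∀ h m k →
  ∣nodeTop∣ h (suc m) (suc k) ℕ.+ ((h ℕ.+ m) C⁻ k) ℕ.* (m C suc k) ≡ ((h ℕ.+ m) C k) ℕ.* (m C k)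

-- The count is 0, since a lone leaf has no products, and the two rows of the determinant coincide.
∣leafTop∣-determinant zero    m k = *-comm (m C⁻ k) (m C k)
∣leafTop∣-determinant (suc h) m zero = cong (ℕ._+ 0) (begin
  ∣leafTop∣ (suc h) (suc m) 0                         ≡⟨ ∣leafTop∣-suc h (suc m) 0 ⟩
  ∣leafTop∣ h (suc m) 0 ℕ.+ ∣nodeTop∣ h (suc m) 0     ≡⟨ cong (∣leafTop∣ h (suc m) 0 ℕ.+_) (∣nodeTop∣-zero h (suc m)) ⟩
  ∣leafTop∣ h (suc m) 0 ℕ.+ 0                         ≡⟨ ∣leafTop∣-determinant h m 0 ⟩
  0                                                   ∎)
  where open ≡-Reasoning
∣leafTop∣-determinant (suc h) m (suc k) = begin
  ∣leafTop∣ (suc h) (suc m) (suc k) ℕ.+ (suc n C k) ℕ.* b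
    ≡⟨ cong₂ (λ w z → w ℕ.+ z ℕ.* b) (∣leafTop∣-suc h (suc m) (suc k)) (sym (pascal n k)) ⟩
  (x ℕ.+ y) ℕ.+ ((n C⁻ k) ℕ.+ (n C k)) ℕ.* b
    -- Linearity of the determinant in the row `n`, expanded by Pascal's rule: `n C k` goes with the
    -- leaf count, `n C⁻ k` with the node count.
    ≡⟨ split x y (n C⁻ k) (n C k) b ⟩
  (x ℕ.+ (n C k) ℕ.* b) ℕ.+ (y ℕ.+ (n C⁻ k) ℕ.* b)
    ≡⟨ cong₂ ℕ._+_ (∣leafTop∣-determinant h m (suc k)) (∣nodeTop∣-determinant h m k) ⟩
  (n C suc k) ℕ.* a ℕ.+ (n C k) ℕ.* a
    ≡⟨ merge (n C k) (n C suc k) a ⟩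
  ((n C k) ℕ.+ (n C suc k)) ℕ.* a
    ≡⟨ cong (ℕ._* a) (pascal n (suc k)) ⟩
  (suc n C suc k) ℕ.* a ∎
  where
  open ≡-Reasoning
  n = h ℕ.+ m
  a = m C k
  b = m C suc k
  x = ∣leafTop∣ h (suc m) (suc k)
  y = ∣nodeTop∣ h (suc m) (suc k)
  split : ∀ x y p q b → (x ℕ.+ y) ℕ.+ (p ℕ.+ q) ℕ.* b ≡ (x ℕ.+ q ℕ.* b) ℕ.+ (y ℕ.+ p ℕ.* b)
  split = solve-∀
  merge : ∀ q r a → r ℕ.* a ℕ.+ q ℕ.* a ≡ (q ℕ.+ r) ℕ.* a
  merge = solve-∀

∣nodeTop∣-determinant h zero k = begin
  ∣nodeTop∣ h 1 (suc k) ℕ.+ p ℕ.* 0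
    ≡⟨ cong₂ ℕ._+_ (trans (∣nodeTop∣-suc h 0 k) (+-identityʳ _)) (*-zeroʳ p) ⟩
  ∣leafTop∣ (suc h) 0 k ℕ.+ 0            ≡⟨ +-identityʳ _ ⟩
  ∣leafTop∣ (suc h) 0 k                  ≡⟨ ∣leafTop∣-base (suc h) k ⟩
  0 C k                                  ≡⟨ collapse k ⟩
  ((h ℕ.+ 0) C k) ℕ.* (0 C k)            ∎
  where
  open ≡-Reasoning
  p = (h ℕ.+ 0) C⁻ k
  collapse : ∀ k → 0 C k ≡ ((h ℕ.+ 0) C k) ℕ.* (0 C k)
  collapse zero    = refl
  collapse (suc k) = sym (*-zeroʳ ((h ℕ.+ 0) C suc k))
-- The rewrite gives both induction hypotheses, at height `suc h`, the same row `suc (h + m)`;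
-- Pascal's rule now expands the row of `suc m`.
∣nodeTop∣-determinant h (suc m) k rewrite +-suc h m = begin
  ∣nodeTop∣ h (suc (suc m)) (suc k) ℕ.+ p ℕ.* (suc m C suc k)
    ≡⟨ cong₂ (λ w z → w ℕ.+ p ℕ.* z) (∣nodeTop∣-suc h (suc m) k) (sym (pascal m (suc k))) ⟩
  (x ℕ.+ y) ℕ.+ p ℕ.* (a ℕ.+ b)
    ≡⟨ split x y p a b ⟩
  (x ℕ.+ p ℕ.* a) ℕ.+ (y ℕ.+ p ℕ.* b)
    ≡⟨ cong₂ ℕ._+_ (∣leafTop∣-determinant (suc h) m k) (∣nodeTop∣-determinant (suc h) m k) ⟩
  q ℕ.* z ℕ.+ q ℕ.* a
    ≡⟨ merge q z a ⟩
  q ℕ.* (z ℕ.+ a)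
    ≡⟨ cong (q ℕ.*_) (pascal m k) ⟩
  q ℕ.* (suc m C k) ∎
  where
  open ≡-Reasoning
  p = suc (h ℕ.+ m) C⁻ k
  q = suc (h ℕ.+ m) C k
  z = m C⁻ k
  a = m C k
  b = m C suc k
  x = ∣leafTop∣ (suc h) (suc m) k
  y = ∣nodeTop∣ (suc h) (suc m) (suc k)
  split : ∀ x y p a b → (x ℕ.+ y) ℕ.+ p ℕ.* (a ℕ.+ b) ≡ (x ℕ.+ p ℕ.* a) ℕ.+ (y ℕ.+ p ℕ.* b)
  split = solve-∀
  merge : ∀ q z a → q ℕ.* z ℕ.+ q ℕ.* a ≡ q ℕ.* (z ℕ.+ a)
  merge = solve-∀

-- From the determinant to the Narayana formula

narayana : ∀ m k → k ≤ m →
  suc m ℕ.* ∣nodeTop∣ 0 (suc m) (suc k) ≡ (suc m C suc k) ℕ.* (suc m C k)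
narayana m k k≤m with q , refl ← m≤n⇒∃[o]m+o≡n k≤m = begin
  -- At height 0 the determinant is `a * a - z * b`; adding `suc m * (z * b)` to both sides avoids
  -- the subtraction.
  suc m ℕ.* y                       ≡⟨ +-cancelʳ-≡ (suc m ℕ.* (z ℕ.* b)) _ _ shifted ⟩
  (a ℕ.+ b) ℕ.* (z ℕ.+ a)           ≡⟨ cong₂ ℕ._*_ (pascal m (suc k)) (pascal m k) ⟩
  (suc m C suc k) ℕ.* (suc m C k)   ∎
  where
  open ≡-Reasoning
  y = ∣nodeTop∣ 0 (suc m) (suc k)
  z = m C⁻ k
  a = m C k
  b = m C suc k

  distribute : ∀ m y w → suc m ℕ.* y ℕ.+ suc m ℕ.* w ≡ suc m ℕ.* (y ℕ.+ w)
  distribute = solve-∀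
  expand₁ : ∀ k q a → suc (k ℕ.+ q) ℕ.* (a ℕ.* a) ≡
    a ℕ.* a ℕ.+ k ℕ.* a ℕ.* a ℕ.+ q ℕ.* a ℕ.* a
  expand₁ = solve-∀
  expand₂ : ∀ k q z a b → (a ℕ.+ b) ℕ.* (z ℕ.+ a) ℕ.+ suc (k ℕ.+ q) ℕ.* (z ℕ.* b) ≡
    suc k ℕ.* b ℕ.* z ℕ.+ (a ℕ.* z ℕ.+ a ℕ.* a ℕ.+ a ℕ.* b ℕ.+ suc q ℕ.* z ℕ.* b)
  expand₂ = solve-∀
  expand₃ : ∀ k q z a b →
    q ℕ.* a ℕ.* z ℕ.+ (a ℕ.* z ℕ.+ a ℕ.* a ℕ.+ a ℕ.* b ℕ.+ k ℕ.* a ℕ.* b) ≡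
    suc q ℕ.* z ℕ.* a ℕ.+ (a ℕ.* a ℕ.+ suc k ℕ.* b ℕ.* a)
  expand₃ = solve-∀
  reorder : ∀ u v w → v ℕ.+ (u ℕ.+ w) ≡ u ℕ.+ v ℕ.+ w
  reorder = solve-∀

  shifted : suc m ℕ.* y ℕ.+ suc m ℕ.* (z ℕ.* b) ≡
            (a ℕ.+ b) ℕ.* (z ℕ.+ a) ℕ.+ suc m ℕ.* (z ℕ.* b)
  shifted = begin
    suc m ℕ.* y ℕ.+ suc m ℕ.* (z ℕ.* b)
      ≡⟨ distribute m y (z ℕ.* b) ⟩
    suc m ℕ.* (y ℕ.+ z ℕ.* b)
      ≡⟨ cong (suc m ℕ.*_) (∣nodeTop∣-determinant 0 m k) ⟩
    suc m ℕ.* (a ℕ.* a)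
      ≡⟨ expand₁ k q a ⟩
    a ℕ.* a ℕ.+ k ℕ.* a ℕ.* a ℕ.+ q ℕ.* a ℕ.* a
      -- Absorption trades `k * a` for `suc q * z` and `q * a` for `suc k * b`.
      ≡⟨ cong₂ (λ v w → a ℕ.* a ℕ.+ v ℕ.* a ℕ.+ w ℕ.* a) (absorption⁻ k q) (sym (absorption′ k q)) ⟩
    a ℕ.* a ℕ.+ suc q ℕ.* z ℕ.* a ℕ.+ suc k ℕ.* b ℕ.* a
      ≡⟨ reorder (a ℕ.* a) (suc q ℕ.* z ℕ.* a) (suc k ℕ.* b ℕ.* a) ⟨
    suc q ℕ.* z ℕ.* a ℕ.+ (a ℕ.* a ℕ.+ suc k ℕ.* b ℕ.* a)
      -- Splitting off one `a * z` and one `a * b` leaves `q * a * z` and `k * a * b`, to which the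
      -- same two trades apply with the partners `z` and `b` exchanged.
      ≡⟨ expand₃ k q z a b ⟨
    q ℕ.* a ℕ.* z ℕ.+ (a ℕ.* z ℕ.+ a ℕ.* a ℕ.+ a ℕ.* b ℕ.+ k ℕ.* a ℕ.* b)
      ≡⟨ cong₂ (λ v w → v ℕ.* z ℕ.+ (a ℕ.* z ℕ.+ a ℕ.* a ℕ.+ a ℕ.* b ℕ.+ w ℕ.* b))
               (sym (absorption′ k q)) (absorption⁻ k q) ⟩
    suc k ℕ.* b ℕ.* z ℕ.+ (a ℕ.* z ℕ.+ a ℕ.* a ℕ.+ a ℕ.* b ℕ.+ suc q ℕ.* z ℕ.* b)
      ≡⟨ expand₂ k q z a b ⟨
    (a ℕ.+ b) ℕ.* (z ℕ.+ a) ℕ.+ suc m ℕ.* (z ℕ.* b) ∎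

-- For unnormalised rationals equality is cross-multiplication, so no common factors need to be
-- cancelled.
solve-for-factor : ∀ m N A B → suc m ℕ.* N ≡ A ℕ.* B →
                   + N / 1 ≡ (+ 1 / suc m) * (+ A / 1) * (+ B / 1)
solve-for-factor m N A B eq = toℚᵘ-injective (begin
  toℚᵘ (+ N / 1)
    ≈⟨ toℚᵘ-fromℚᵘ (ℚᵘ.mkℚᵘ (+ N) 0) ⟩
  ℚᵘ.mkℚᵘ (+ N) 0
    ≈⟨ ℚᵘ.*≡* cross ⟩
  ℚᵘ.mkℚᵘ (+ 1) m ℚᵘ.* ℚᵘ.mkℚᵘ (+ A) 0 ℚᵘ.* ℚᵘ.mkℚᵘ (+ B) 0
    ≈⟨ ℚᵘ.*-cong (ℚᵘ.*-cong (toℚᵘ-fromℚᵘ (ℚᵘ.mkℚᵘ (+ 1) m)) (toℚᵘ-fromℚᵘ (ℚᵘ.mkℚᵘ (+ A) 0)))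
                 (toℚᵘ-fromℚᵘ (ℚᵘ.mkℚᵘ (+ B) 0)) ⟨
  toℚᵘ (+ 1 / suc m) ℚᵘ.* toℚᵘ (+ A / 1) ℚᵘ.* toℚᵘ (+ B / 1)
    ≈⟨ ℚᵘ.*-congʳ (toℚᵘ-homo-* (+ 1 / suc m) (+ A / 1)) ⟨
  toℚᵘ ((+ 1 / suc m) * (+ A / 1)) ℚᵘ.* toℚᵘ (+ B / 1)
    ≈⟨ toℚᵘ-homo-* ((+ 1 / suc m) * (+ A / 1)) (+ B / 1) ⟨
  toℚᵘ ((+ 1 / suc m) * (+ A / 1) * (+ B / 1)) ∎)
  where
  open ℚᵘ.≃-Reasoning
  cross : + N ℤ.* + (suc m ℕ.* 1 ℕ.* 1) ≡ + 1 ℤ.* + A ℤ.* + B ℤ.* + 1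
  cross = trans (sym (ℤ.pos-* N _)) (trans (cong +_ (trans (units N m) eq)) (trans (ℤ.pos-* A B)
    (sym (trans (ℤ.*-identityʳ _) (cong (ℤ._* + B) (ℤ.*-identityˡ (+ A)))))))
    where
    units : ∀ N m → N ℕ.* (suc m ℕ.* 1 ℕ.* 1) ≡ suc m ℕ.* N
    units = solve-∀

proposition5 : ∀ {c ℓ} (F : CatalanNormedMagma c ℓ) (n k : ℕ) .{{_ : NonZero (n ∸ 1)}} →
    1 ≤ k → k ≤ n ∸ 1 →
    ∃[ N ] (HasCardinality (ElementsOf F n k) N ×
      + N / 1 ≡ (+ 1 / (n ∸ 1)) * (+ ((n ∸ 1) C k) / 1) * (+ ((n ∸ 1) C (k ∸ 1)) / 1))
-- The bounds on `k` force `n = m + 2` and a positive `k`; the matched `k` is the original one minus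
-- 1.
proposition5 F (suc (suc m)) (suc k) (s≤s _) (s≤s k≤m) =
  ∣nodeTop∣ 0 (suc m) (suc k) ,
  ElementsOf-cardinality F m (suc k) ,
  solve-for-factor m _ (suc m C suc k) (suc m C k) (narayana m k k≤m)
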